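{- Let $G$ be a connected, well-edge-dominated graph containing exactly one triangle $xyz$. If $\deg_G(y)=2$, $\deg_G(x)\ge 3$ and $\deg_G(z)\ge 3$, then $G\in\{\mathcal{H},\mathcal{DH}\}$.
   Context: All graphs are simple and finite. A set $F$ of edges of $G$ is an edge dominating set if every edge of $G$ is in $F$ or shares an endpoint with an edge of $F$. $G$ is well-edge-dominated if all minimal (with respect to inclusion) edge dominating sets of $G$ have the same cardinality. A triangle is a subgraph isomorphic to $K_3$. The house graph $\mathcal{H}$ has vertices $p_1,\dots,p_5$ and edges $p_1p_2,p_2p_3,p_3p_4,p_4p_1,p_3p_5,p_4p_5$. The dream house $\mathcal{DH}$ has vertices $q_1,\dots,q_7$ and edges $q_1q_2,q_2q_3,q_3q_4,q_4q_1,q_2q_5,q_3q_6,q_5q_6,q_5q_7,q_6q_7$. Membership in $\{\mathcal{H},\mathcal{DH}\}$ is up to isomorphism. -}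

module Defs where

open import Data.Nat using (ℕ; zero; suc; _≥_)
open import Data.Nat.Base using (_≡ᵇ_)
open import Data.Fin using (Fin; toℕ; _<_)
open import Data.Bool using (Bool; true; false; T; _∧_; _∨_; not)
open import Data.List using (List; []; _∷_; length; allFin; filterᵇ)
open import Data.Bool.ListAction using (any)
open import Data.List.Membership.Propositional using (_∈_)
open import Data.List.Relation.Unary.All using (All)
open import Data.List.Relation.Unary.Unique.Propositional using (Unique)
open import Data.Product using (_×_; _,_; Σ; ∃-syntax)
open import Data.Sum using (_⊎_)
open import Relation.Binary.PropositionalEquality using (_≡_; _≢_)
open import Relation.Nullary using (¬_)
open import Function.Bundles using (_↔_; Inverse)

Adj : ℕ → Set
Adj n = Fin n → Fin n → Bool

record IsSimple {n : ℕ} (G : Adj n) : Set where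
  field
    sym     : ∀ u v → G u v ≡ G v u
    irrefl  : ∀ u → G u u ≡ false

deg : {n : ℕ} → Adj n → Fin n → ℕ
deg {n} G v = length (filterᵇ (G v) (allFin n))

data Walk {n : ℕ} (G : Adj n) : Fin n → Fin n → Set where
  here  : ∀ {u} → Walk G u u
  step  : ∀ {u v w} → T (G u v) → Walk G v w → Walk G u w

Connected : {n : ℕ} → Adj n → Set
Connected G = ∀ u v → Walk G u v

-- An edge {u,v} is stored as an ordered pair (u , v) with u < v.
Edge : ℕ → Set
Edge n = Fin n × Fin n

IsEdge : {n : ℕ} → Adj n → Edge n → Set
IsEdge G (u , v) = (u < v) × T (G u v)

-- a set of edges of G: duplicate-free list of edges of G; cardinality = length
record EdgeSet {n : ℕ} (G : Adj n) (F : List (Edge n)) : Set where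
  field
    edges  : All (IsEdge G) F
    unique : Unique F

Touch : {n : ℕ} → Edge n → Edge n → Set
Touch (a , b) (c , d) = (a ≡ c) ⊎ (a ≡ d) ⊎ (b ≡ c) ⊎ (b ≡ d)

IsEDS : {n : ℕ} → Adj n → List (Edge n) → Set
IsEDS G F = EdgeSet G F × (∀ e → IsEdge G e → e ∈ F ⊎ (∃[ f ] (f ∈ F × Touch e f)))

_⊆_ : {n : ℕ} → List (Edge n) → List (Edge n) → Set
F ⊆ F' = ∀ {e} → e ∈ F → e ∈ F'

IsMinimalEDS : {n : ℕ} → Adj n → List (Edge n) → Set
IsMinimalEDS G F = IsEDS G F × (∀ F' → IsEDS G F' → F' ⊆ F → F ⊆ F')

WellEdgeDominated : {n : ℕ} → Adj n → Set
WellEdgeDominated G =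
  ∀ F F' → IsMinimalEDS G F → IsMinimalEDS G F' → length F ≡ length F'

IsTriangle : {n : ℕ} → Adj n → Fin n → Fin n → Fin n → Set
IsTriangle G x y z =
  (x ≢ y) × (y ≢ z) × (x ≢ z) × T (G x y) × T (G y z) × T (G x z)

InTri : {n : ℕ} → Fin n → Fin n → Fin n → Fin n → Set
InTri x y z a = (a ≡ x) ⊎ (a ≡ y) ⊎ (a ≡ z)

UniqueTriangle : {n : ℕ} → Adj n → Fin n → Fin n → Fin n → Set
UniqueTriangle G x y z =
  IsTriangle G x y z ×
  (∀ a b c → IsTriangle G a b c → InTri x y z a × InTri x y z b × InTri x y z c)

fromEdges : {k : ℕ} → List (ℕ × ℕ) → Adj k
fromEdges es u v = any (λ { (a , b) → ((toℕ u ≡ᵇ a) ∧ (toℕ v ≡ᵇ b)) ∨ ((toℕ u ≡ᵇ b) ∧ (toℕ v ≡ᵇ a)) }) es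

-- house: p1..p5 ↦ 0..4
House : Adj 5
House = fromEdges ((0 , 1) ∷ (1 , 2) ∷ (2 , 3) ∷ (3 , 0) ∷ (2 , 4) ∷ (3 , 4) ∷ [])

-- dream house: q1..q7 ↦ 0..6
DreamHouse : Adj 7
DreamHouse = fromEdges ((0 , 1) ∷ (1 , 2) ∷ (2 , 3) ∷ (3 , 0) ∷ (1 , 4) ∷ (2 , 5)
                        ∷ (4 , 5) ∷ (4 , 6) ∷ (5 , 6) ∷ [])

Iso : {n m : ℕ} → Adj n → Adj m → Set
Iso {n} {m} G H = Σ (Fin n ↔ Fin m) λ φ → ∀ u v → G u v ≡ H (Inverse.to φ u) (Inverse.to φ v)

{-# OPTIONS --safe #-}

-- A maximal matching is a minimal edge dominating set, so all maximal matchings have equal size.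
-- Let A and B be the neighbours of x and of z off the triangle and H = G − {x , y , z}. Exchanging
-- x z for z y (or x y) shows that every maximal matching of H covers A ∪ B; exchanging {x a , z b}
-- for x z then shows that A is completely joined to B. Along walks, every maximal matching of H
-- covers all of H, which forces H to be complete bipartite with a perfect matching. Finally G has no
-- K₂,₃ whose complement is perfectly matched, since a star with three leaves may replace two matching
-- edges in it; this leaves H = K₂ (the house) or H = C₄ with |A| = |B| = 1 (the dream house).

module Submission where

open import Defs
open import Data.Nat using (ℕ; suc; _≥_; _+_; s≤s)
open import Data.Nat.Properties using (m≢1+m+n; suc-injective; 1+n≢n)
open import Data.Fin using (Fin; zero; suc; _≟_; _<_)
open import Data.Fin.Properties using (<-cmp; any?)
import Data.Fin.Properties as Fin
import Data.Bool.Properties as Bool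
open import Data.Bool using (Bool; true; false; T; T?)
open import Data.Empty using (⊥; ⊥-elim)
open import Data.List using (List; []; _∷_; _++_; length; map; allFin; cartesianProduct; filterᵇ; tabulate; lookup)
open import Data.List.Properties using (length-++; length-map)
open import Data.List.Membership.Propositional using (_∈_)
open import Data.List.Membership.Propositional.Properties
  using (∈-map⁺; ∈-map⁻; ∈-filter⁺; ∈-allFin; ∈-cartesianProduct⁺; ∈-tabulate⁻)
open import Data.List.Relation.Unary.All as All using (All; []; _∷_; all?)
import Data.List.Relation.Unary.All.Properties as All
open import Data.List.Relation.Unary.Any using (here; there)
open import Data.List.Relation.Unary.AllPairs using (AllPairs; []; _∷_)
import Data.List.Relation.Unary.AllPairs.Properties as AllPairs
open import Data.List.Relation.Unary.Unique.Propositional using (Unique)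
open import Data.List.Relation.Unary.Unique.Propositional.Properties using (allFin⁺)
open import Data.Product using (_×_; _,_; ∃-syntax; proj₁; proj₂)
open import Data.Sum using (_⊎_; inj₁; inj₂; [_,_]′)
open import Function using (_∘_)
open import Function.Bundles using (mk↔ₛ′)
open import Relation.Binary using (DecidableEquality; tri<; tri≈; tri>)
open import Relation.Binary.PropositionalEquality
  using (_≡_; _≢_; refl; sym; trans; cong; cong₂; subst; ≢-sym)
open import Relation.Nullary using (¬_; Dec; yes; no; ¬?)
open import Relation.Nullary.Decidable using (_×-dec_; from-yes)

-- Missed vertices, and touching up to orientation

Fresh : {n : ℕ} → Fin n → List (Fin n) → Set
Fresh u C = All (u ≢_) C

fresh? : {n : ℕ} (u : Fin n) (C : List (Fin n)) → Dec (Fresh u C)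
fresh? u = all? (λ v → ¬? (u ≟ v))

¬fresh⇒∈ : {n : ℕ} {u : Fin n} (C : List (Fin n)) → ¬ Fresh u C → u ∈ C
¬fresh⇒∈ [] ¬f = ⊥-elim (¬f [])
¬fresh⇒∈ {u = u} (c ∷ C) ¬f with u ≟ c
... | yes refl = here refl
... | no u≢c   = there (¬fresh⇒∈ C (λ f → ¬f (u≢c ∷ f)))

-- Edges are handled as pairs in either orientation and only sorted at the end, by normalise.
cover : {n : ℕ} → List (Edge n) → List (Fin n)
cover []            = []
cover ((u , v) ∷ F) = u ∷ v ∷ cover F

∈-cover : {n : ℕ} {u : Fin n} (F : List (Edge n)) → u ∈ cover F →
  ∃[ f ] (f ∈ F × (u ≡ proj₁ f ⊎ u ≡ proj₂ f))
∈-cover (f ∷ F) (here eq)          = f , here refl , inj₁ eq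
∈-cover (f ∷ F) (there (here eq))  = f , here refl , inj₂ eq
∈-cover (f ∷ F) (there (there u∈)) with ∈-cover F u∈
... | g , g∈ , h = g , there g∈ , h

fresh-++ : {n : ℕ} {u : Fin n} (M : List (Edge n)) {N : List (Edge n)} →
  Fresh u (cover M) → Fresh u (cover N) → Fresh u (cover (M ++ N))
fresh-++ [] _ f = f
fresh-++ (_ ∷ M) (p ∷ q ∷ e) f = p ∷ q ∷ fresh-++ M e f

fresh-++⁻ : {n : ℕ} {u : Fin n} (M : List (Edge n)) {N : List (Edge n)} →
  Fresh u (cover (M ++ N)) → Fresh u (cover M) × Fresh u (cover N)
fresh-++⁻ [] f = [] , f
fresh-++⁻ (_ ∷ M) (p ∷ q ∷ f) with fresh-++⁻ M f
... | e , g = p ∷ q ∷ e , g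

normalise : {n : ℕ} → Edge n → Edge n
normalise (u , v) with <-cmp u v
... | tri< _ _ _ = u , v
... | tri≈ _ _ _ = u , v
... | tri> _ _ _ = v , u

touch-normalise : {n : ℕ} (p e : Edge n) → Touch p e → Touch p (normalise e)
touch-normalise p (u , v) t with <-cmp u v
... | tri< _ _ _ = t
... | tri≈ _ _ _ = t
... | tri> _ _ _ = swap t
  where
  swap : Touch p (u , v) → Touch p (v , u)
  swap (inj₁ x) = inj₂ (inj₁ x)
  swap (inj₂ (inj₁ x)) = inj₁ x
  swap (inj₂ (inj₂ (inj₁ x))) = inj₂ (inj₂ (inj₂ x))
  swap (inj₂ (inj₂ (inj₂ x))) = inj₂ (inj₂ (inj₁ x))

touch-unnormalise : {n : ℕ} (p e : Edge n) → Touch p (normalise e) → Touch p e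
touch-unnormalise p (u , v) t with <-cmp u v
... | tri< _ _ _ = t
... | tri≈ _ _ _ = t
... | tri> _ _ _ = swap t
  where
  swap : Touch p (v , u) → Touch p (u , v)
  swap (inj₁ x) = inj₂ (inj₁ x)
  swap (inj₂ (inj₁ x)) = inj₁ x
  swap (inj₂ (inj₂ (inj₁ x))) = inj₂ (inj₂ (inj₂ x))
  swap (inj₂ (inj₂ (inj₂ x))) = inj₂ (inj₂ (inj₁ x))

touch-swap : {n : ℕ} {p e : Edge n} → Touch p e → Touch e p
touch-swap (inj₁ x)               = inj₁ (sym x)
touch-swap (inj₂ (inj₁ x))        = inj₂ (inj₂ (inj₁ (sym x)))
touch-swap (inj₂ (inj₂ (inj₁ x))) = inj₂ (inj₁ (sym x))
touch-swap (inj₂ (inj₂ (inj₂ x))) = inj₂ (inj₂ (inj₂ (sym x)))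

fresh⇒¬touch : {n : ℕ} {u v : Fin n} {F : List (Edge n)} → Fresh u (cover F) → Fresh v (cover F) →
  All (λ f → ¬ Touch (u , v) f) F
fresh⇒¬touch {F = []} _ _ = []
fresh⇒¬touch {F = _ ∷ F} (a ∷ b ∷ f) (c ∷ d ∷ g) =
  [ a , [ b , [ c , d ]′ ]′ ]′ ∷ fresh⇒¬touch f g

-- Isomorphisms given by an enumeration of the vertices

on : {b : Bool} → T b → b ≡ true
on {true} _ = refl

off : {b : Bool} → ¬ T b → b ≡ false
off {false} _ = refl
off {true} ¬t = ⊥-elim (¬t _)

module _ {A : Set} {R : A → A → Set} where

  allPairs-tabulate⁻ : ∀ {m} {f : Fin m → A} → AllPairs R (tabulate f) →
    ∀ {i j} → i < j → R (f i) (f j)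
  allPairs-tabulate⁻ {suc _} (r ∷ _) {zero} {suc j} _ = All.tabulate⁻ r j
  allPairs-tabulate⁻ {suc _} (_ ∷ s) {suc i} {suc j} (s≤s lt) = allPairs-tabulate⁻ s lt

unique-tabulate⁻ : ∀ {A : Set} {m} {f : Fin m → A} → Unique (tabulate f) →
  ∀ {i j} → f i ≡ f j → i ≡ j
unique-tabulate⁻ s {i} {j} eq with <-cmp i j
... | tri< lt _ _ = ⊥-elim (allPairs-tabulate⁻ s lt eq)
... | tri≈ _ e _  = e
... | tri> _ _ gt = ⊥-elim (allPairs-tabulate⁻ s gt (sym eq))

-- Simplicity of both graphs reduces the comparison to pairs `i < j`, so a concrete isomorphism
-- needs only the upper triangle of the adjacency matrix. The map out of `G` sends a vertex to its
-- position in the enumeration.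
iso : {n m : ℕ} (G : Adj n) → IsSimple G → (f : Fin m → Fin n) → Unique (tabulate f) →
  (∀ u → u ∈ tabulate f) → (H : Adj m) → IsSimple H →
  AllPairs (λ i j → G (f i) (f j) ≡ H i j) (allFin m) → Iso G H
iso {n} {m} G S f uniq surj H SH adj = mk↔ₛ′ g f left right , preserves
  where
  g : Fin n → Fin m
  g u = proj₁ (∈-tabulate⁻ (surj u))
  right : ∀ u → f (g u) ≡ u
  right u = sym (proj₂ (∈-tabulate⁻ (surj u)))
  left : ∀ i → g (f i) ≡ i
  left i = unique-tabulate⁻ uniq (right (f i))
  entry : ∀ i j → G (f i) (f j) ≡ H i j
  entry i j with <-cmp i j
  ... | tri< lt _ _   = allPairs-tabulate⁻ adj lt
  ... | tri≈ _ refl _ = trans (IsSimple.irrefl S (f i)) (sym (IsSimple.irrefl SH i))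
  ... | tri> _ _ gt   =
    trans (IsSimple.sym S (f i) (f j)) (trans (allPairs-tabulate⁻ adj gt) (IsSimple.sym SH j i))
  preserves : ∀ u v → G u v ≡ H (g u) (g v)
  preserves u v = trans (cong₂ G (sym (right u)) (sym (right v))) (entry (g u) (g v))

House-simple : IsSimple House
House-simple = record
  { sym    = from-yes (Fin.all? λ u → Fin.all? λ v → House u v Bool.≟ House v u)
  ; irrefl = from-yes (Fin.all? λ u → House u u Bool.≟ false) }

DreamHouse-simple : IsSimple DreamHouse
DreamHouse-simple = record
  { sym    = from-yes (Fin.all? λ u → Fin.all? λ v → DreamHouse u v Bool.≟ DreamHouse v u)
  ; irrefl = from-yes (Fin.all? λ u → DreamHouse u u Bool.≟ false) }

-- Minimal edge dominating sets certified by private edges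

module Graph {n : ℕ} (G : Adj n) (S : IsSimple G) where

  infix 4 _~_
  _~_ : Fin n → Fin n → Set
  u ~ v = T (G u v)

  ~-sym : {u v : Fin n} → u ~ v → v ~ u
  ~-sym {u} {v} = subst T (IsSimple.sym S u v)

  ~⇒≢ : {u v : Fin n} → u ~ v → u ≢ v
  ~⇒≢ {u} e refl = subst T (IsSimple.irrefl S u) e

  normalise-edge : (u v : Fin n) → u ~ v → IsEdge G (normalise (u , v))
  normalise-edge u v e with <-cmp u v
  ... | tri< lt _ _ = lt , e
  ... | tri≈ _ eq _ = ⊥-elim (~⇒≢ e eq)
  ... | tri> _ _ gt = gt , ~-sym e

  -- Phrased through covered vertices, this ignores the order and orientation of the edges. Since
  -- freshness is decidable, `dominated` recovers a touching member.
  Dominating : List (Edge n) → Set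
  Dominating F = ∀ u v → u ~ v → Fresh u (cover F) → Fresh v (cover F) → ⊥

  -- The first edge is a member of the set, the second an edge it dominates, which `Separate` then
  -- makes private.
  Witness : Edge n × Edge n → Set
  Witness ((a , b) , (p , q)) = a ~ b × p ~ q × Touch (p , q) (a , b)

  Separate : Edge n × Edge n → Edge n × Edge n → Set
  Separate (e , p) (e′ , p′) = ¬ Touch p e′ × ¬ Touch p′ e

  dominated : {F : List (Edge n)} → Dominating F → ∀ u v → u ~ v → ∃[ f ] (f ∈ F × Touch (u , v) f)
  dominated {F} dom u v e with fresh? u (cover F) | fresh? v (cover F)
  ... | yes fu | yes fv = ⊥-elim (dom u v e fu fv)
  ... | no ¬fu | _ with ∈-cover F (¬fresh⇒∈ (cover F) ¬fu)
  ...   | f , f∈ , inj₁ x = f , f∈ , inj₁ x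
  ...   | f , f∈ , inj₂ x = f , f∈ , inj₂ (inj₁ x)
  dominated {F} dom u v e | yes _ | no ¬fv with ∈-cover F (¬fresh⇒∈ (cover F) ¬fv)
  ...   | f , f∈ , inj₁ x = f , f∈ , inj₂ (inj₂ (inj₁ x))
  ...   | f , f∈ , inj₂ x = f , f∈ , inj₂ (inj₂ (inj₂ x))

  separate-∈ : {L : List (Edge n × Edge n)} → AllPairs Separate L → ∀ {e p e′ p′} →
    (e , p) ∈ L → (e′ , p′) ∈ L → Touch p e′ → e′ ≡ e
  separate-∈ (_ ∷ _)  (here refl) (here refl) _ = refl
  separate-∈ (ss ∷ _) (here refl) (there j)   t = ⊥-elim (proj₁ (All.lookup ss j) t)
  separate-∈ (ss ∷ _) (there i)   (here refl) t = ⊥-elim (proj₂ (All.lookup ss i) t)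
  separate-∈ (_ ∷ s)  (there i)   (there j)   t = separate-∈ s i j t

  normalised : List (Edge n × Edge n) → List (Edge n)
  normalised = map (normalise ∘ proj₁)

  normalised-∈ : {L : List (Edge n × Edge n)} {f : Edge n} → f ∈ normalised L →
    ∃[ e ] ∃[ p ] ((e , p) ∈ L × f ≡ normalise e)
  normalised-∈ f∈ with ∈-map⁻ (normalise ∘ proj₁) f∈
  ... | (e , p) , i , eq = e , p , i , eq

  normalised-unique : {L : List (Edge n × Edge n)} → All Witness L → AllPairs Separate L →
    Unique (normalised L)
  normalised-unique [] [] = []
  normalised-unique {(e , p) ∷ L} ((_ , _ , t) ∷ ws) (ss ∷ s) =
    All.map⁺ (All.map distinct ss) ∷ normalised-unique ws s
    where
    distinct : ∀ {ep} → Separate (e , p) ep → normalise e ≢ normalise (proj₁ ep)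
    distinct {e′ , _} (¬t , _) eq =
      -- Equal normal forms would let the private edge `p` of `e` touch `e′`.
      ¬t (touch-unnormalise p e′ (subst (Touch p) eq (touch-normalise p e t)))

  -- In a pair (e , p) of L, p is a private edge of e: no other member of the list dominates it.
  private⇒minimal : {L : List (Edge n × Edge n)} → All Witness L → AllPairs Separate L →
    Dominating (map proj₁ L) → IsMinimalEDS G (normalised L)
  private⇒minimal {L} ws s dom = (record { edges = edges ; unique = normalised-unique ws s } , eds) , minimal
    where
    edges : All (IsEdge G) (normalised L)
    edges = All.map⁺ (All.map (λ { {(a , b) , _} (e , _) → normalise-edge a b e }) ws)
    eds : ∀ e → IsEdge G e → e ∈ normalised L ⊎ (∃[ f ] (f ∈ normalised L × Touch e f))
    eds (u , v) (_ , e) with dominated dom u v e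
    ... | f , f∈ , t with ∈-map⁻ proj₁ f∈
    ...   | _ , i , refl =
      inj₂ (normalise f , ∈-map⁺ (normalise ∘ proj₁) i , touch-normalise (u , v) f t)
    minimal : ∀ F′ → IsEDS G F′ → F′ ⊆ normalised L → normalised L ⊆ F′
    minimal F′ (_ , dom′) sub f∈ with normalised-∈ f∈
    ... | e , (p , q) , i , refl = found
      where
      pq : p ~ q
      pq = proj₁ (proj₂ (All.lookup ws i))
      -- `F′` has to dominate the private edge `(p , q)`. The member that does so lies in
      -- `normalised L`, hence is `normalise e` itself.
      via : ∀ {g} → g ∈ F′ → Touch (p , q) g → normalise e ∈ F′
      via g∈ t with normalised-∈ (sub g∈)
      ... | e′ , p′ , i′ , refl with separate-∈ s i i′ (touch-unnormalise (p , q) e′ t)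
      ...   | refl = g∈
      found : normalise e ∈ F′
      found with dom′ (normalise (p , q)) (normalise-edge p q pq)
      ... | inj₁ g∈ = via g∈ (touch-normalise (p , q) (p , q) (inj₁ refl))
      ... | inj₂ (g , g∈ , t) =
        via g∈ (touch-swap (touch-unnormalise g (p , q) (touch-swap t)))

  -- Matchings and their maximal extensions

  data Matching : List (Edge n) → Set where
    []  : Matching []
    add : ∀ {u v M} → u ~ v → Fresh u (cover M) → Fresh v (cover M) → Matching M →
          Matching ((u , v) ∷ M)

  record Maximal (M : List (Edge n)) : Set where
    constructor maximal
    field
      matching   : Matching M
      dominating : Dominating M
  open Maximal public

  -- Distinct edges of a matching never touch, so each can serve as its own private edge.
  selfWitnessed : List (Edge n) → List (Edge n × Edge n)
  selfWitnessed = map (λ e → e , e)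

  matching-witness : ∀ {M} → Matching M → All Witness (selfWitnessed M)
  matching-witness [] = []
  matching-witness (add e _ _ m) = (e , e , inj₁ refl) ∷ matching-witness m

  matching-separate : ∀ {M} → Matching M → AllPairs Separate (selfWitnessed M)
  matching-separate [] = []
  matching-separate (add _ fu fv m) =
    All.map⁺ (All.map (λ ¬t → ¬t , ¬t ∘ touch-swap) (fresh⇒¬touch fu fv)) ∷ matching-separate m

  map-proj₁-selfWitnessed : ∀ M → map proj₁ (selfWitnessed M) ≡ M
  map-proj₁-selfWitnessed [] = refl
  map-proj₁-selfWitnessed (e ∷ M) = cong (e ∷_) (map-proj₁-selfWitnessed M)

  length-normalised : ∀ L → length (normalised L) ≡ length L
  length-normalised = length-map (normalise ∘ proj₁)

  maximal⇒minimal : ∀ {M} → Maximal M → IsMinimalEDS G (normalised (selfWitnessed M))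
  maximal⇒minimal {M} (maximal m d) = private⇒minimal (matching-witness m) (matching-separate m)
    (subst Dominating (sym (map-proj₁-selfWitnessed M)) d)

  length-selfWitnessed : ∀ M → length (normalised (selfWitnessed M)) ≡ length M
  length-selfWitnessed M = trans (length-normalised (selfWitnessed M)) (length-map (λ e → e , e) M)

  matching-++ : ∀ {M N} → Matching M → Matching N → All (λ c → Fresh c (cover N)) (cover M) →
    Matching (M ++ N)
  matching-++ [] mN _ = mN
  matching-++ {_ ∷ M} (add e fu fv m) mN (gu ∷ gv ∷ g) =
    add e (fresh-++ M fu gu) (fresh-++ M fv gv) (matching-++ m mN g)

  -- A candidate from `ps` is added if it is an edge that avoids `C` and all edges chosen so far; a
  -- rejected one can never become free later. `extend` takes for `C` the cover of `M` and for `ps`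
  -- all ordered pairs.
  greedy : (C : List (Fin n)) (ps : List (Edge n)) →
    ∃[ N ] (Matching N × All (λ c → Fresh c (cover N)) C ×
      (∀ u v → (u , v) ∈ ps → u ~ v → Fresh u C → Fresh v C →
        Fresh u (cover N) → Fresh v (cover N) → ⊥))
  greedy C [] = [] , [] , All.universal (λ _ → []) C , λ _ _ ()
  greedy C ((u , v) ∷ ps) with greedy C ps
  ... | N , m , f , d
    with T? (G u v) ×-dec fresh? u C ×-dec fresh? v C ×-dec fresh? u (cover N) ×-dec fresh? v (cover N)
  ... | yes (e , cu , cv , fu , fv) = (u , v) ∷ N , add e fu fv m , extended , dom
    where
    extended : All (λ c → Fresh c (u ∷ v ∷ cover N)) C
    extended = All.zipWith (λ { (p , q , r) → ≢-sym p ∷ ≢-sym q ∷ r }) (cu , All.zip (cv , f))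
    dom : ∀ u′ v′ → (u′ , v′) ∈ (u , v) ∷ ps → u′ ~ v′ → Fresh u′ C → Fresh v′ C →
      Fresh u′ (u ∷ v ∷ cover N) → Fresh v′ (u ∷ v ∷ cover N) → ⊥
    dom u′ v′ (here refl) _ _ _ (p ∷ _) _ = p refl
    dom u′ v′ (there i) e′ c d′ (_ ∷ _ ∷ p) (_ ∷ _ ∷ q) = d u′ v′ i e′ c d′ p q
  ... | no ¬p = N , m , f , dom
    where
    dom : ∀ u′ v′ → (u′ , v′) ∈ (u , v) ∷ ps → u′ ~ v′ → Fresh u′ C → Fresh v′ C →
      Fresh u′ (cover N) → Fresh v′ (cover N) → ⊥
    dom u′ v′ (here refl) e c d′ p q = ¬p (e , c , d′ , p , q)
    dom u′ v′ (there i) = d u′ v′ i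

  extend : ∀ {M} → Matching M → ∃[ N ] Maximal (M ++ N)
  extend {M} m with greedy (cover M) (cartesianProduct (allFin n) (allFin n))
  ... | N , mN , f , d = N , maximal (matching-++ m mN f) dom
    where
    dom : Dominating (M ++ N)
    dom u v e fu fv with fresh-++⁻ M fu | fresh-++⁻ M fv
    ... | cu , nu | cv , nv =
      d u v (∈-cartesianProduct⁺ (∈-allFin u) (∈-allFin v)) e cu cv nu nv

  record FreeEdge (M : List (Edge n)) : Set where
    constructor free
    field
      {u v} : Fin n
      edge  : u ~ v
      left  : Fresh u (cover M)
      right : Fresh v (cover M)

  freeEdge? : ∀ M → Dec (∃[ u ] ∃[ v ] (u ~ v × Fresh u (cover M) × Fresh v (cover M)))
  freeEdge? M = any? λ u → any? λ v → T? (G u v) ×-dec fresh? u (cover M) ×-dec fresh? v (cover M)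

  -- Brings the edge at `v` to the front, starting with `v`, ready for an exchange. The size is what
  -- `same-size` needs to carry maximality over, and `transfer` keeps track of the missed vertices.
  record Matched (v : Fin n) (R : List (Edge n)) : Set where
    constructor matched
    field
      partner  : Fin n
      rest     : List (Edge n)
      rematch  : Matching ((v , partner) ∷ rest)
      size     : length R ≡ suc (length rest)
      transfer : ∀ {u} → Fresh u (cover R) → Fresh u (v ∷ partner ∷ cover rest)

  find : ∀ {R v} → Matching R → v ∈ cover R → Matched v R
  find {(a , b) ∷ R} m (here refl) = matched b R m refl (λ f → f)
  find {(a , b) ∷ R} (add e fa fb m) (there (here refl)) =
    matched a R (add (~-sym e) fb fa m) refl (λ { (p ∷ q ∷ r) → q ∷ p ∷ r })
  find {(a , b) ∷ R} (add e fa fb m) (there (there i)) with find m i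
  ... | matched v′ R′ (add e′ fv fv′ m′) s tr with tr fa | tr fb
  ...   | a1 ∷ a2 ∷ fa′ | b1 ∷ b2 ∷ fb′ =
    matched v′ ((a , b) ∷ R′)
      (add e′ (≢-sym a1 ∷ ≢-sym b1 ∷ fv) (≢-sym a2 ∷ ≢-sym b2 ∷ fv′) (add e fa′ fb′ m′)) (cong suc s)
      (λ { (p ∷ q ∷ r) → let p′ , q′ , r′ = shuffle (tr r) in p′ ∷ q′ ∷ p ∷ q ∷ r′ })
    where
    shuffle : ∀ {u p q C} → Fresh {n} u (p ∷ q ∷ C) → u ≢ p × u ≢ q × Fresh u C
    shuffle (p ∷ q ∷ r) = p , q , r

  -- Exchange arguments from equal sizes

  module Equimatchable (W : WellEdgeDominated G) where

    equal-size : ∀ {M N} → Maximal M → Maximal N → length M ≡ length N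
    equal-size {M} {N} mM mN =
      trans (sym (length-selfWitnessed M))
        (trans (W _ _ (maximal⇒minimal mM) (maximal⇒minimal mN)) (length-selfWitnessed N))

    -- A matching one edge short cannot be maximal, and the search for a free edge is finite.
    augment : ∀ {M N} → Maximal M → Matching N → length M ≡ suc (length N) → FreeEdge N
    augment {M} {N} mM mN eq with freeEdge? N
    ... | yes (u , v , e , fu , fv) = free e fu fv
    ... | no ¬free = ⊥-elim (1+n≢n (trans (sym eq) (equal-size mM
      (maximal mN (λ u v e fu fv → ¬free (u , v , e , fu , fv))))))

    -- A free edge could be added to `N` and the result extended to a maximal matching of larger
    -- size. Hence every exchange that keeps the size keeps maximality.
    same-size : ∀ {M N} → Maximal M → Matching N → length M ≡ length N → Maximal N
    same-size {M} {N} mM mN eq = maximal mN dom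
      where
      dom : Dominating N
      dom u v e fu fv with extend (add e fu fv mN)
      ... | K , mK = m≢1+m+n (length N)
        (trans (sym eq) (trans (equal-size mM mK) (cong suc (length-++ N))))

    -- On a K₂,₃ with sides {c , d} and {l₁ , l₂ , l₃} whose complement is perfectly matched by M,
    -- the star c l₁, c l₂, c l₃ (with private edges lᵢ d) competes with the matching c l₁, d l₂.
    no-K₂₃ : ∀ {c d l₁ l₂ l₃ M} → Matching ((c , l₁) ∷ (d , l₂) ∷ M) →
      Fresh l₃ (c ∷ l₁ ∷ d ∷ l₂ ∷ cover M) → c ~ l₂ → c ~ l₃ → d ~ l₁ → d ~ l₃ →
      (∀ u → Fresh u (c ∷ l₁ ∷ d ∷ l₂ ∷ cover M) → u ≡ l₃) → ⊥
    no-K₂₃ {c} {d} {l₁} {l₂} {l₃} {M}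
      mat@(add cl₁ (c≢d ∷ c≢l₂ ∷ fc) (l₁≢d ∷ l₁≢l₂ ∷ f₁) (add dl₂ fd f₂ m))
      (l₃≢c ∷ l₃≢l₁ ∷ l₃≢d ∷ l₃≢l₂ ∷ f₃) cl₂ cl₃ dl₁ dl₃ only =
      1+n≢n (suc-injective (suc-injective (trans (sym sizeL) (trans
        (W _ _ (private⇒minimal witness separate domL) (maximal⇒minimal (maximal mat dom′)))
        (length-selfWitnessed ((c , l₁) ∷ (d , l₂) ∷ M))))))
      where
      c≢l₁ : c ≢ l₁
      c≢l₁ = ~⇒≢ cl₁
      L : List (Edge n × Edge n)
      L = ((c , l₁) , (l₁ , d)) ∷ ((c , l₂) , (l₂ , d)) ∷ ((c , l₃) , (l₃ , d)) ∷ selfWitnessed M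
      sizeL : length (normalised L) ≡ 3 + length M
      sizeL = cong (3 +_) (length-selfWitnessed M)
      dom′ : Dominating ((c , l₁) ∷ (d , l₂) ∷ M)
      -- The matching misses only `l₃`, and a single vertex spans no edge.
      dom′ u v e fu fv = ~⇒≢ e (trans (only u fu) (sym (only v fv)))
      leaf : ∀ {c l} → c ~ l → d ~ l → Witness ((c , l) , (l , d))
      leaf e e′ = e , ~-sym e′ , inj₂ (inj₁ refl)
      witness : All Witness L
      witness = leaf cl₁ dl₁ ∷ leaf cl₂ dl₂ ∷ leaf cl₃ dl₃ ∷ matching-witness m
      leaves : ∀ {l k} → c ≢ l → c ≢ k → l ≢ k → d ≢ l → d ≢ k →
        Separate ((c , l) , (l , d)) ((c , k) , (k , d))
      leaves c≢l c≢k l≢k d≢l d≢k =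
        [ ≢-sym c≢l , [ l≢k , [ ≢-sym c≢d , d≢k ]′ ]′ ]′ ,
        [ ≢-sym c≢k , [ ≢-sym l≢k , [ ≢-sym c≢d , d≢l ]′ ]′ ]′
      outside : ∀ {l} → Fresh l (cover M) →
        All (Separate ((c , l) , (l , d))) (selfWitnessed M)
      outside fl = All.map⁺ (All.zipWith (λ { (s , t) → s , t ∘ touch-swap })
        (fresh⇒¬touch fl fd , fresh⇒¬touch fc fl))
      separate : AllPairs Separate L
      separate =
        (leaves c≢l₁ c≢l₂ l₁≢l₂ (≢-sym l₁≢d) (~⇒≢ dl₂)
          ∷ leaves c≢l₁ (≢-sym l₃≢c) (≢-sym l₃≢l₁) (≢-sym l₁≢d) (≢-sym l₃≢d) ∷ outside f₁)
        ∷ (leaves c≢l₂ (≢-sym l₃≢c) (≢-sym l₃≢l₂) (~⇒≢ dl₂) (≢-sym l₃≢d) ∷ outside f₂)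
        ∷ outside f₃ ∷ matching-separate m
      domL : Dominating (map proj₁ L)
      -- Likewise the star together with `M` misses no vertex other than `d`.
      domL rewrite map-proj₁-selfWitnessed M = λ u v e fu fv → ~⇒≢ e (trans (isD u fu) (sym (isD v fv)))
        where
        isD : ∀ u → Fresh u (c ∷ l₁ ∷ c ∷ l₂ ∷ c ∷ l₃ ∷ cover M) → u ≡ d
        isD u (p ∷ q ∷ _ ∷ r ∷ _ ∷ s ∷ f) with u ≟ d
        ... | yes eq = eq
        ... | no u≢d = ⊥-elim (s (only u (p ∷ q ∷ u≢d ∷ r ∷ f)))

    -- The triangle and the vertices off it

    record Roof (x y z : Fin n) : Set where
      field
        xy    : x ~ y
        yz    : y ~ z
        xz    : x ~ z
        y-nbr : ∀ {u} → y ~ u → u ≡ x ⊎ u ≡ z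
        tri   : ∀ {u v w} → u ~ v → v ~ w → u ~ w → InTri x y z u

    -- The hypotheses are symmetric in `x` and `z`, so a fact about `x` yields its mirror image.
    flip : ∀ {x y z} → Roof x y z → Roof z y x
    flip {x} {y} {z} R = record
      { xy = ~-sym yz ; yz = ~-sym xy ; xz = ~-sym xz ; y-nbr = [ inj₂ , inj₁ ]′ ∘ y-nbr
      ; tri = λ e f g → turn (tri e f g) }
      where
      open Roof R
      turn : ∀ {u} → InTri x y z u → InTri z y x u
      turn (inj₁ p)        = inj₂ (inj₂ p)
      turn (inj₂ (inj₁ p)) = inj₂ (inj₁ p)
      turn (inj₂ (inj₂ p)) = inj₁ p

    module OnRoof {x y z : Fin n} (roof : Roof x y z) where
      open Roof roof

      x≢z : x ≢ z
      x≢z = ~⇒≢ xz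

      x≢y : x ≢ y
      x≢y = ~⇒≢ xy

      y≢z : y ≢ z
      y≢z = ~⇒≢ yz

      record Outside (u : Fin n) : Set where
        constructor outside
        field
          ≢x : u ≢ x
          ≢y : u ≢ y
          ≢z : u ≢ z
      open Outside public

      triangle-free : ∀ {u v w} → Outside u → u ~ v → v ~ w → u ~ w → ⊥
      triangle-free (outside p q r) e f g = [ p , [ q , r ]′ ]′ (tri e f g)

      y≁ : ∀ {u} → u ≢ x → u ≢ z → ¬ (y ~ u)
      y≁ p q e = [ p , q ]′ (y-nbr e)

      inner : ∀ {u v} → u ~ v → u ≢ x → u ≢ z → v ≢ x → v ≢ z → Outside u
      inner e p q r s = outside p (λ { refl → y≁ r s e }) q

      -- An edge at `y` would cover `x` or `z`, its only neighbours.
      y-fresh : ∀ {R} → Matching R → Fresh x (cover R) → Fresh z (cover R) → Fresh y (cover R)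
      y-fresh {R} m fx fz with fresh? y (cover R)
      ... | yes f = f
      ... | no ¬f with find m (¬fresh⇒∈ _ ¬f)
      ...   | matched y′ R′ (add e _ _ _) _ tr with tr fx | tr fz
      ...     | _ ∷ p ∷ _ | _ ∷ q ∷ _ = ⊥-elim (y≁ (≢-sym p) (≢-sym q) e)

      -- As `y` has no neighbour besides `x` and `z`, these `R` are exactly the maximal matchings of
      -- `H`; each of them has to cover `u`.
      Essential : Fin n → Set
      Essential u = ∀ {R} → Maximal ((x , z) ∷ R) → Fresh u (cover R) → ⊥

      -- Exchange x z for z y: this is again maximal, so it must dominate the edge x a.
      essential-x : ∀ {a} → x ~ a → Outside a → Essential a
      essential-x e o mM@(maximal (add _ fx fz m) _) fa =
        dominating (same-size mM (add (~-sym yz) fz (y-fresh m fx fz) m) refl) _ _ e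
          (x≢z ∷ x≢y ∷ fx) (≢z o ∷ ≢y o ∷ fa)

    -- Vertices covered by every maximal matching of `H`

    module TwoSided {x y z : Fin n} (roof : Roof x y z) where
      open Roof roof
      open OnRoof roof public
      module Z = OnRoof (flip roof)

      essential-z : ∀ {b} → z ~ b → Outside b → Essential b
      essential-z e o mM@(maximal (add _ fx fz m) _) fb =
        -- In the flipped roof the triangle edge reads `z x`, so it is reversed first.
        Z.essential-x e (Z.outside (≢z o) (≢y o) (≢x o)) (same-size mM (add (~-sym xz) fz fx m) refl) fb

      -- Otherwise compare {x a, z b} ∪ R with {x z} ∪ R: the latter extends by an edge at a or b,
      -- and then leaves the other one uncovered.
      joined : ∀ {a b} → x ~ a → Outside a → z ~ b → Outside b → a ~ b
      joined {a} {b} xa oa zb ob with T? (G a b)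
      ... | yes ab = ab
      ... | no ¬ab with extend (add xa (x≢z ∷ ≢-sym (≢x ob) ∷ []) (≢z oa ∷ a≢b ∷ []) (add zb [] [] []))
        where
        a≢b : a ≢ b
        a≢b refl = triangle-free oa (~-sym xa) xz (~-sym zb)
      ...   | R , mM@(maximal (add _ (_ ∷ _ ∷ fx) (_ ∷ a≢b ∷ fa) (add _ fz fb m)) dom)
        with augment mM (add xz fx fz m) refl
      ...     | free {u} {v} e fu@(u≢x ∷ u≢z ∷ fu′) fv@(v≢x ∷ v≢z ∷ fv′) = cases
        where
        -- A free edge at `a` does not end in `b`, so adding it to `x z` and `R` gives a maximal
        -- matching that misses `b`.
        at-a : ∀ {v} → a ~ v → Fresh v (x ∷ z ∷ cover R) → ⊥
        at-a {v} av (p ∷ q ∷ fv) = essential-z zb ob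
          (same-size mM (add xz (≢-sym (≢x oa) ∷ ≢-sym p ∷ fx) (≢-sym (≢z oa) ∷ ≢-sym q ∷ fz) (add av fa fv m)) refl)
          (≢-sym a≢b ∷ (λ { refl → ¬ab av }) ∷ fb)
        at-b : ∀ {v} → b ~ v → Fresh v (x ∷ z ∷ cover R) → ⊥
        at-b {v} bv (p ∷ q ∷ fv) = essential-x xa oa
          (same-size mM (add xz (≢-sym (≢x ob) ∷ ≢-sym p ∷ fx) (≢-sym (≢z ob) ∷ ≢-sym q ∷ fz) (add bv fb fv m)) refl)
          (a≢b ∷ (λ { refl → ¬ab (~-sym bv) }) ∷ fa)
        cases : a ~ b
        cases with u ≟ a | u ≟ b | v ≟ a | v ≟ b
        ... | yes refl | _ | _ | _ = ⊥-elim (at-a e fv)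
        ... | no _ | yes refl | _ | _ = ⊥-elim (at-b e fv)
        ... | no _ | no _ | yes refl | _ = ⊥-elim (at-a (~-sym e) fu)
        ... | no _ | no _ | no _ | yes refl = ⊥-elim (at-b (~-sym e) fu)
        -- A free edge away from `a` and `b` would already be free for `x a`, `z b` and `R`.
        ... | no p | no q | no r | no s =
          ⊥-elim (dom u v e (u≢x ∷ p ∷ u≢z ∷ q ∷ fu′) (v≢x ∷ r ∷ v≢z ∷ s ∷ fv′))

      -- The partners of v and w in a matching that misses u cannot all be re-matched without
      -- exposing w.
      module Step {u v w : Fin n} (ou : Outside u) (ov : Outside v) (ow : Outside w)
        (ev : Essential v) (ew : Essential w) (vw : v ~ w) (vu : v ~ u) (w≢u : w ≢ u) where

        step₂ : ∀ {v′ w′ R} → Maximal ((x , z) ∷ (v , v′) ∷ (w , w′) ∷ R) →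
          Fresh u (v ∷ v′ ∷ w ∷ w′ ∷ cover R) → ⊥
        step₂ {v′} {w′} {R}
          mM@(maximal (add _ (x≢v ∷ x≢v′ ∷ x≢w ∷ x≢w′ ∷ fx) (z≢v ∷ z≢v′ ∷ z≢w ∷ z≢w′ ∷ fz)
            (add vv′ (v≢w ∷ v≢w′ ∷ fv) (v′≢w ∷ v′≢w′ ∷ fv′) (add ww′ fw fw′ m))) dom)
          fu₀@(u≢v ∷ u≢v′ ∷ u≢w ∷ u≢w′ ∷ fu)
          -- Merging `v v′` and `w w′` into `v w` loses one edge, so some edge `p q` is free.
          with augment mM (add xz (x≢v ∷ x≢w ∷ fx) (z≢v ∷ z≢w ∷ fz) (add vw fv fw m)) refl
        ... | free {p} {q} e fp@(p≢x ∷ p≢z ∷ p≢v ∷ p≢w ∷ fp′) fq@(q≢x ∷ q≢z ∷ q≢v ∷ q≢w ∷ fq′) = cases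
          where
          at-u : ∀ {q} → u ~ q → Fresh q (x ∷ z ∷ v ∷ w ∷ cover R) → ⊥
          at-u {q} uq (q≢x ∷ q≢z ∷ q≢v ∷ q≢w ∷ fq) with q ≟ v′ | q ≟ w′
          -- The free edge is `u q`. If `q` is `v′`, then `u`, `v`, `v′` form a triangle; if `q` is
          -- `w′`, keeping `v v′` and adding `u w′` exposes `w`; any other `q` contradicts the
          -- original maximality.
          ... | yes refl | _ = triangle-free ou (~-sym vu) vv′ uq
          ... | no _ | yes refl = ew
            (same-size mM (add xz (≢-sym (≢x ou) ∷ x≢w′ ∷ x≢v ∷ x≢v′ ∷ fx) (≢-sym (≢z ou) ∷ z≢w′ ∷ z≢v ∷ z≢v′ ∷ fz)
              (add uq (u≢v ∷ u≢v′ ∷ fu) (≢-sym v≢w′ ∷ ≢-sym v′≢w′ ∷ fw′) (add vv′ fv fv′ m))) refl)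
            (w≢u ∷ ~⇒≢ ww′ ∷ ≢-sym v≢w ∷ ≢-sym v′≢w ∷ fw)
          ... | no q≢v′ | no q≢w′ = dom u q uq (≢x ou ∷ ≢z ou ∷ fu₀)
            (q≢x ∷ q≢z ∷ q≢v ∷ q≢v′ ∷ q≢w ∷ q≢w′ ∷ fq)
          cases : ⊥
          cases with p ≟ u | q ≟ u
          ... | yes refl | _ = at-u e fq
          ... | no _ | yes refl = at-u (~-sym e) fp
          -- Here `v u` and `p q` replace `v v′` and `w w′`, which exposes `w`.
          ... | no p≢u | no q≢u = ew
            (same-size mM (add xz (x≢v ∷ ≢-sym (≢x ou) ∷ ≢-sym p≢x ∷ ≢-sym q≢x ∷ fx)
              (z≢v ∷ ≢-sym (≢z ou) ∷ ≢-sym p≢z ∷ ≢-sym q≢z ∷ fz)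
              (add vu (≢-sym p≢v ∷ ≢-sym q≢v ∷ fv) (≢-sym p≢u ∷ ≢-sym q≢u ∷ fu) (add e fp′ fq′ m))) refl)
            (≢-sym v≢w ∷ w≢u ∷ ≢-sym p≢w ∷ ≢-sym q≢w ∷ fw)

        step₁ : ∀ {v′ R} → Maximal ((x , z) ∷ (v , v′) ∷ R) → Fresh u (v ∷ v′ ∷ cover R) → ⊥
        step₁ {v′} {R}
          mM@(maximal (add _ (x≢v ∷ x≢v′ ∷ fx) (z≢v ∷ z≢v′ ∷ fz) (add vv′ fv fv′ m)) _)
          fu₀@(u≢v ∷ u≢v′ ∷ fu) with w ≟ v′ | fresh? w (cover R)
        ... | yes refl | _ = ew
          (same-size mM (add xz (x≢v ∷ ≢-sym (≢x ou) ∷ fx) (z≢v ∷ ≢-sym (≢z ou) ∷ fz) (add vu fv fu m)) refl)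
          (≢-sym (~⇒≢ vv′) ∷ w≢u ∷ fv′)
        ... | no w≢v′ | yes fw = ew mM (≢-sym (~⇒≢ vw) ∷ w≢v′ ∷ fw)
        ... | no w≢v′ | no ¬fw with find m (¬fresh⇒∈ _ ¬fw)
        ...   | matched w′ R′ m′ s tr = step₂
          (same-size mM (add xz (x≢v ∷ x≢v′ ∷ tr fx) (z≢v ∷ z≢v′ ∷ tr fz) (add vv′ (tr fv) (tr fv′) m′))
            (cong (2 +_) s))
          (u≢v ∷ u≢v′ ∷ tr fu)

        essential : Essential u
        essential {R} mM@(maximal (add _ fx fz m) _) fu with fresh? v (cover R)
        ... | yes fv = ev mM fv
        ... | no ¬fv with find m (¬fresh⇒∈ _ ¬fv)
        ...   | matched v′ R′ m′ s tr =
          step₁ (same-size mM (add xz (tr fx) (tr fz) m′) (cong suc s)) (tr fu)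

      essential-step : ∀ {u v w} → Outside u → Outside v → Outside w →
        Essential v → Essential w → v ~ w → v ~ u → Essential u
      essential-step {u} {v} {w} ou ov ow ev ew vw vu with w ≟ u
      ... | yes refl = ew
      ... | no w≢u   = Step.essential ou ov ow ev ew vw vu w≢u

      outside? : ∀ u → Outside u ⊎ InTri x y z u
      outside? u with u ≟ x | u ≟ y | u ≟ z
      ... | yes p | _ | _ = inj₂ (inj₁ p)
      ... | no _ | yes p | _ = inj₂ (inj₂ (inj₁ p))
      ... | no _ | no _ | yes p = inj₂ (inj₂ (inj₂ p))
      ... | no p | no q | no r = inj₁ (outside p q r)

      -- Induction along a walk from `x`. The walk may re-enter the triangle, but it can leave only
      -- through `x` or `z`, where `px` or `pz` starts the induction afresh.
      spread : (P : Fin n → Set) → Connected G →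
        (∀ {u} → x ~ u → Outside u → P u) → (∀ {u} → z ~ u → Outside u → P u) →
        (∀ {u v} → Outside v → P v → v ~ u → Outside u → P u) →
        ∀ {u} → Outside u → P u
      spread P conn px pz next {u} = along (conn x u) (λ o → ⊥-elim (≢x o refl))
        where
        along : ∀ {v u} → Walk G v u → (Outside v → P v) → Outside u → P u
        along here pv = pv
        along {v} (step {v = t} e w) pv = along w pt
          where
          pt : Outside t → P t
          pt o with outside? v
          ... | inj₁ ov                 = next ov (pv ov) e o
          ... | inj₂ (inj₁ refl)        = px e o
          ... | inj₂ (inj₂ (inj₁ refl)) = ⊥-elim (y≁ (≢x o) (≢z o) e)
          ... | inj₂ (inj₂ (inj₂ refl)) = pz e o

      -- `H` is complete bipartite with a perfect matching

      module Attached (conn : Connected G) {a b : Fin n}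
        (xa : x ~ a) (oa : Outside a) (zb : z ~ b) (ob : Outside b) where

        ab : a ~ b
        ab = joined xa oa zb ob

        -- `essential-step` needs a second essential vertex next to `v`, so the induction carries
        -- one along: the mate of the new vertex is its predecessor.
        record Good (u : Fin n) : Set where
          constructor good
          field
            {mate}  : Fin n
            own     : Essential u
            mate-o  : Outside mate
            mate-e  : Essential mate
            joined′ : u ~ mate

        all-essential : ∀ {u} → Outside u → Essential u
        all-essential o = Good.own (spread Good conn
          (λ e o → good (essential-x e o) ob (essential-z zb ob) (joined e o zb ob))
          (λ e o → good (essential-z e o) oa (essential-x xa oa) (~-sym (joined xa oa e o)))
          (λ { ov (good ev ow ew vw) e o → good (essential-step o ov ow ev ew vw e) ov ev (~-sym e) })
          o)

        -- Extend `x z`, `p q`, `r s` to a maximal matching and replace the last two by `q r`. Some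
        -- edge is now free, but the only missed vertices of `H` are `p` and `s`.
        close-path : ∀ {p q r s} → Outside p → Outside q → Outside r → Outside s →
          p ~ q → q ~ r → r ~ s → p ≢ r → q ≢ s → p ≢ s → p ~ s
        close-path {p} {q} {r} {s} op oq or os pq qr rs p≢r q≢s p≢s
          with extend (add xz (≢-sym (≢x op) ∷ ≢-sym (≢x oq) ∷ ≢-sym (≢x or) ∷ ≢-sym (≢x os) ∷ [])
                              (≢-sym (≢z op) ∷ ≢-sym (≢z oq) ∷ ≢-sym (≢z or) ∷ ≢-sym (≢z os) ∷ [])
                 (add pq (p≢r ∷ p≢s ∷ []) (~⇒≢ qr ∷ q≢s ∷ []) (add rs [] [] [])))
        ... | N , mM@(maximal (add _ (_ ∷ x≢q ∷ x≢r ∷ _ ∷ fx) (_ ∷ z≢q ∷ z≢r ∷ _ ∷ fz)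
                (add _ _ (_ ∷ _ ∷ fq) (add _ fr _ m))) _)
          with augment mM (add xz (x≢q ∷ x≢r ∷ fx) (z≢q ∷ z≢r ∷ fz) (add qr fq fr m)) refl
        ...   | free {u} {v} e (u≢x ∷ u≢z ∷ u≢q ∷ u≢r ∷ fu) (v≢x ∷ v≢z ∷ v≢q ∷ v≢r ∷ fv)
          with end (inner e u≢x u≢z v≢x v≢z) u≢q u≢r fu | end (inner (~-sym e) v≢x v≢z u≢x u≢z) v≢q v≢r fv
          where
          end : ∀ {u} → Outside u → u ≢ q → u ≢ r → Fresh u (cover N) → u ≡ p ⊎ u ≡ s
          end {u} ou u≢q u≢r fu with u ≟ p | u ≟ s
          ... | yes eq | _ = inj₁ eq
          ... | no _ | yes eq = inj₂ eq
          ... | no u≢p | no u≢s = ⊥-elim (all-essential ou mM (u≢p ∷ u≢q ∷ u≢r ∷ u≢s ∷ fu))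
        ... | inj₁ refl | inj₁ refl = ⊥-elim (~⇒≢ e refl)
        ... | inj₁ refl | inj₂ refl = e
        ... | inj₂ refl | inj₁ refl = ~-sym e
        ... | inj₂ refl | inj₂ refl = ⊥-elim (~⇒≢ e refl)

        -- For a neighbour `u` of `v`, the path `u v a b` or `u v b a` closes to a 4-cycle; the
        -- degenerate cases are immediate or give triangles. This yields the two sides of `H`.
        side : ∀ {u} → Outside u → u ~ a ⊎ u ~ b
        side = spread (λ u → u ~ a ⊎ u ~ b) conn
          (λ e o → inj₂ (joined e o zb ob)) (λ e o → inj₁ (~-sym (joined xa oa e o))) next
          where
          next : ∀ {u v} → Outside v → v ~ a ⊎ v ~ b → v ~ u → Outside u → u ~ a ⊎ u ~ b
          next {u} {v} ov (inj₁ va) vu ou with u ≟ a | v ≟ b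
          ... | yes refl | _ = inj₂ ab
          ... | no _ | yes refl = inj₂ (~-sym vu)
          ... | no u≢a | no v≢b = inj₂ (close-path ou ov oa ob (~-sym vu) va ab u≢a v≢b
            (λ { refl → triangle-free ou (~-sym vu) va (~-sym ab) }))
          next {u} {v} ov (inj₂ vb) vu ou with u ≟ b | v ≟ a
          ... | yes refl | _ = inj₁ (~-sym ab)
          ... | no _ | yes refl = inj₁ (~-sym vu)
          ... | no u≢b | no v≢a = inj₁ (close-path ou ov ob oa (~-sym vu) vb (~-sym ab) u≢b v≢a
            (λ { refl → triangle-free ou (~-sym vu) vb ab }))

        -- Close the path `p b a q`.
        cross : ∀ {p q} → Outside p → Outside q → p ~ b → q ~ a → p ~ q
        cross {p} {q} op oq pb qa with p ≟ a | q ≟ b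
        ... | yes refl | _ = ~-sym qa
        ... | no _ | yes refl = pb
        ... | no p≢a | no q≢b = close-path op ob oa oq pb (~-sym ab) (~-sym qa) p≢a (≢-sym q≢b)
          (λ { refl → triangle-free op pb (~-sym ab) qa })

        ¬both : ∀ {u} → Outside u → u ~ a → u ~ b → ⊥
        ¬both o ua ub = triangle-free o ua ab ub

        -- `p` lies on the side of `a` and `q` on the side of `b`.
        Oriented : Edge n → Set
        Oriented (p , q) = Outside p × Outside q × p ~ b × q ~ a

        record Orientation (N : List (Edge n)) : Set where
          constructor orientation
          field
            {result} : List (Edge n)
            isMatch  : Matching result
            size     : length N ≡ length result
            oriented : All Oriented result
            transfer : ∀ {u} → Fresh u (cover N) → Fresh u (cover result)

        -- Adjacent vertices on the same side would form a triangle with `a` or `b`, so each edge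
        -- joins the two sides and can be turned the right way.
        orient : ∀ {N} → Matching N → Fresh x (cover N) → Fresh y (cover N) → Fresh z (cover N) →
          Orientation N
        orient [] _ _ _ = orientation [] refl [] (λ f → f)
        orient (add {p} {q} pq fp fq m) (x≢p ∷ x≢q ∷ fx) (y≢p ∷ y≢q ∷ fy) (z≢p ∷ z≢q ∷ fz)
          with orient m fx fy fz
        ... | orientation m′ s or tr = cases
          where
          op : Outside p
          op = outside (≢-sym x≢p) (≢-sym y≢p) (≢-sym z≢p)
          oq : Outside q
          oq = outside (≢-sym x≢q) (≢-sym y≢q) (≢-sym z≢q)
          cases : Orientation _
          cases with side op | side oq
          ... | inj₁ pa | inj₁ qa = ⊥-elim (triangle-free op pq qa pa)
          ... | inj₂ pb | inj₂ qb = ⊥-elim (triangle-free op pq qb pb)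
          ... | inj₂ pb | inj₁ qa = orientation (add pq (tr fp) (tr fq) m′) (cong suc s)
            ((op , oq , pb , qa) ∷ or) (λ { (f ∷ g ∷ h) → f ∷ g ∷ tr h })
          ... | inj₁ pa | inj₂ qb = orientation (add (~-sym pq) (tr fq) (tr fp) m′) (cong suc s)
            ((oq , op , qb , pa) ∷ or) (λ { (f ∷ g ∷ h) → g ∷ f ∷ tr h })

        covers : ∀ {N} → Maximal ((x , z) ∷ N) → ∀ u → u ∈ x ∷ y ∷ z ∷ cover N
        covers {N} mM u = ¬fresh⇒∈ _ λ { (p ∷ q ∷ r ∷ f) → all-essential (outside p q r) mM f }

        -- The `K₂,₃` has sides `q`, `s` and `p`, `r`, `a`; its complement is matched by `z b`,
        -- `x y` and `N`.
        at-most-two : ∀ {p q r s N} → Oriented (p , q) → Oriented (r , s) →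
          Maximal ((x , z) ∷ (a , b) ∷ (p , q) ∷ (r , s) ∷ N) → ⊥
        at-most-two {p} {q} {r} {s} {N} (op , oq , pb , qa) (or , os , rb , sa)
          mM@(maximal (add _ (x≢a ∷ x≢b ∷ x≢p ∷ x≢q ∷ x≢r ∷ x≢s ∷ fx) (z≢a ∷ z≢b ∷ z≢p ∷ z≢q ∷ z≢r ∷ z≢s ∷ fz)
            (add _ (a≢p ∷ a≢q ∷ a≢r ∷ a≢s ∷ fa) (b≢p ∷ b≢q ∷ b≢r ∷ b≢s ∷ fb)
            (add pq (p≢r ∷ p≢s ∷ fp) (q≢r ∷ q≢s ∷ fq) (add rs fr fs m)))) _) =
          no-K₂₃
            (add (~-sym pq) (q≢s ∷ q≢r ∷ ≢-sym z≢q ∷ ≢-sym b≢q ∷ ≢-sym x≢q ∷ ≢y oq ∷ fq)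
                            (p≢s ∷ p≢r ∷ ≢-sym z≢p ∷ ≢-sym b≢p ∷ ≢-sym x≢p ∷ ≢y op ∷ fp)
            (add (~-sym rs) (≢-sym z≢s ∷ ≢-sym b≢s ∷ ≢-sym x≢s ∷ ≢y os ∷ fs)
                            (≢-sym z≢r ∷ ≢-sym b≢r ∷ ≢-sym x≢r ∷ ≢y or ∷ fr)
            (add zb (≢-sym x≢z ∷ ≢-sym y≢z ∷ fz) (≢-sym x≢b ∷ ≢y ob ∷ fb)
            (add xy fx (y-fresh m fx fz) m))))
            (a≢q ∷ a≢p ∷ a≢s ∷ a≢r ∷ ≢z oa ∷ ~⇒≢ ab ∷ ≢x oa ∷ ≢y oa ∷ fa)
            (~-sym (cross or oq rb qa)) qa (~-sym (cross op os pb sa)) sa only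
          where
          only : ∀ u → Fresh u (q ∷ p ∷ s ∷ r ∷ z ∷ b ∷ x ∷ y ∷ cover N) → u ≡ a
          only u (u≢q ∷ u≢p ∷ u≢s ∷ u≢r ∷ u≢z ∷ u≢b ∷ u≢x ∷ u≢y ∷ fu) with u ≟ a
          ... | yes eq = eq
          ... | no u≢a = ⊥-elim (all-essential (outside u≢x u≢y u≢z) mM
            (u≢a ∷ u≢b ∷ u≢p ∷ u≢q ∷ u≢r ∷ u≢s ∷ fu))

        module Square {p q : Fin n} (or : Oriented (p , q))
          (mM : Maximal ((x , z) ∷ (a , b) ∷ (p , q) ∷ [])) where
          private
            op = proj₁ or
            oq = proj₁ (proj₂ or)
            pb = proj₁ (proj₂ (proj₂ or))
            qa = proj₂ (proj₂ (proj₂ or))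

          pq : p ~ q
          pq = cross op oq pb qa

          distinct : Fresh a (p ∷ q ∷ []) × Fresh b (p ∷ q ∷ [])
          distinct = separate (matching mM)
            where
            separate : ∀ {e M} → Matching (e ∷ (a , b) ∷ M) → Fresh a (cover M) × Fresh b (cover M)
            separate (add _ _ _ (add _ f g _)) = f , g

          -- Otherwise `a`, `p` and `b`, `q`, `x` are the sides of a `K₂,₃` whose complement is the
          -- edge `z y`. `z≁q` is the mirror image.
          x≁p : ¬ (x ~ p)
          x≁p xp with distinct
          ... | a≢p ∷ a≢q ∷ [] , b≢p ∷ b≢q ∷ [] = no-K₂₃
            (add ab (a≢p ∷ a≢q ∷ ≢z oa ∷ ≢y oa ∷ []) (b≢p ∷ b≢q ∷ ≢z ob ∷ ≢y ob ∷ [])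
            (add pq (≢z op ∷ ≢y op ∷ []) (≢z oq ∷ ≢y oq ∷ [])
            (add (~-sym yz) [] [] [])))
            (≢-sym (≢x oa) ∷ ≢-sym (≢x ob) ∷ ≢-sym (≢x op) ∷ ≢-sym (≢x oq) ∷ x≢z ∷ x≢y ∷ [])
            (~-sym qa) (~-sym xa) pb (~-sym xp) only
            where
            only : ∀ u → Fresh u (a ∷ b ∷ p ∷ q ∷ z ∷ y ∷ []) → u ≡ x
            only u (f ∷ g ∷ h ∷ i ∷ u≢z ∷ u≢y ∷ []) with u ≟ x
            ... | yes eq = eq
            ... | no u≢x = ⊥-elim (all-essential (outside u≢x u≢y u≢z) mM (f ∷ g ∷ h ∷ i ∷ []))

          z≁q : ¬ (z ~ q)
          z≁q zq with distinct
          ... | a≢p ∷ a≢q ∷ [] , b≢p ∷ b≢q ∷ [] = no-K₂₃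
            (add (~-sym ab) (b≢q ∷ b≢p ∷ ≢x ob ∷ ≢y ob ∷ []) (a≢q ∷ a≢p ∷ ≢x oa ∷ ≢y oa ∷ [])
            (add (~-sym pq) (≢x oq ∷ ≢y oq ∷ []) (≢x op ∷ ≢y op ∷ [])
            (add xy [] [] [])))
            (≢-sym (≢z ob) ∷ ≢-sym (≢z oa) ∷ ≢-sym (≢z oq) ∷ ≢-sym (≢z op) ∷ ≢-sym x≢z ∷ ≢-sym y≢z ∷ [])
            (~-sym pb) (~-sym zb) qa (~-sym zq) only
            where
            only : ∀ u → Fresh u (b ∷ a ∷ q ∷ p ∷ x ∷ y ∷ []) → u ≡ z
            only u (f ∷ g ∷ h ∷ i ∷ u≢x ∷ u≢y ∷ []) with u ≟ z
            ... | yes eq = eq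
            ... | no u≢z = ⊥-elim (all-essential (outside u≢x u≢y u≢z) mM (g ∷ f ∷ i ∷ h ∷ []))

        -- Identification of the graph

        House-or-DreamHouse : Iso G House ⊎ Iso G DreamHouse
        House-or-DreamHouse with extend (add xz (≢-sym (≢x oa) ∷ ≢-sym (≢x ob) ∷ [])
          (≢-sym (≢z oa) ∷ ≢-sym (≢z ob) ∷ []) (add ab [] [] []))
        ... | N , mM@(maximal (add _ (x≢a ∷ x≢b ∷ fx) (z≢a ∷ z≢b ∷ fz) (add _ fa fb m)) _)
          with orient m fx (y-fresh m fx fz) fz
        ... | orientation m′ s or tr = cases or (same-size mM
              (add xz (x≢a ∷ x≢b ∷ tr fx) (z≢a ∷ z≢b ∷ tr fz) (add ab (tr fa) (tr fb) m′)) (cong (2 +_) s))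
          where
          x≁b : ¬ (x ~ b)
          x≁b e = triangle-free ob (~-sym e) xz (~-sym zb)
          a≁z : ¬ (a ~ z)
          a≁z e = triangle-free oa (~-sym xa) xz e
          y≁′ : ∀ {u} → Outside u → ¬ (u ~ y)
          y≁′ o e = y≁ (≢x o) (≢z o) (~-sym e)
          cases : ∀ {R} → All Oriented R → Maximal ((x , z) ∷ (a , b) ∷ R) → Iso G House ⊎ Iso G DreamHouse
          -- No further edge in the matching: the square is `b a x z` and the roof is `y`.
          cases [] mM = inj₁ (iso G S (lookup (b ∷ a ∷ x ∷ z ∷ y ∷ []))
            ((≢-sym (~⇒≢ ab) ∷ ≢x ob ∷ ≢z ob ∷ ≢y ob ∷ []) ∷ (≢x oa ∷ ≢z oa ∷ ≢y oa ∷ []) ∷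
              (x≢z ∷ x≢y ∷ []) ∷ (≢-sym y≢z ∷ []) ∷ [] ∷ [])
            (λ u → case (covers mM u))
            House House-simple
            ((on (~-sym ab) ∷ off (x≁b ∘ ~-sym) ∷ on (~-sym zb) ∷ off (y≁′ ob) ∷ []) ∷
             (on (~-sym xa) ∷ off a≁z ∷ off (y≁′ oa) ∷ []) ∷
             (on xz ∷ on xy ∷ []) ∷ (on (~-sym yz) ∷ []) ∷ [] ∷ []))
            where
            case : ∀ {u} → u ∈ x ∷ y ∷ z ∷ a ∷ b ∷ [] → u ∈ b ∷ a ∷ x ∷ z ∷ y ∷ []
            case (here p) = there (there (here p))
            case (there (here p)) = there (there (there (there (here p))))
            case (there (there (here p))) = there (there (there (here p)))
            case (there (there (there (here p)))) = there (here p)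
            case (there (there (there (there (here p))))) = here p
          -- One further edge: the square `q a b p` shares `a b` with the square `a b z x`, and `y`
          -- is the roof over `x z`.
          cases {(p , q) ∷ []} (o@(op , oq , pb , qa) ∷ []) mM with matching mM
          ... | add _ _ _ (add _ (a≢p ∷ a≢q ∷ []) (b≢p ∷ b≢q ∷ []) _) =
            inj₂ (iso G S (lookup (q ∷ a ∷ b ∷ p ∷ x ∷ z ∷ y ∷ []))
            ((≢-sym a≢q ∷ ≢-sym b≢q ∷ ≢-sym (~⇒≢ pq) ∷ ≢x oq ∷ ≢z oq ∷ ≢y oq ∷ []) ∷
             (~⇒≢ ab ∷ a≢p ∷ ≢x oa ∷ ≢z oa ∷ ≢y oa ∷ []) ∷
             (b≢p ∷ ≢x ob ∷ ≢z ob ∷ ≢y ob ∷ []) ∷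
             (≢x op ∷ ≢z op ∷ ≢y op ∷ []) ∷
             (x≢z ∷ x≢y ∷ []) ∷ (≢-sym y≢z ∷ []) ∷ [] ∷ [])
            (λ u → case (covers mM u))
            DreamHouse DreamHouse-simple
            ((on qa ∷ off (¬both oq qa) ∷ on (~-sym pq) ∷ off q≁x ∷ off (z≁q ∘ ~-sym) ∷ off (y≁′ oq) ∷ []) ∷
             (on ab ∷ off a≁p ∷ on (~-sym xa) ∷ off a≁z ∷ off (y≁′ oa) ∷ []) ∷
             (on (~-sym pb) ∷ off (x≁b ∘ ~-sym) ∷ on (~-sym zb) ∷ off (y≁′ ob) ∷ []) ∷
             (off (x≁p ∘ ~-sym) ∷ off p≁z ∷ off (y≁′ op) ∷ []) ∷
             (on xz ∷ on xy ∷ []) ∷ (on (~-sym yz) ∷ []) ∷ [] ∷ []))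
            where
            open Square o mM
            a≁p : ¬ (a ~ p)
            a≁p e = triangle-free op pb (~-sym ab) (~-sym e)
            q≁x : ¬ (q ~ x)
            q≁x e = triangle-free oq e xa qa
            p≁z : ¬ (p ~ z)
            p≁z e = triangle-free op e zb pb
            case : ∀ {u} → u ∈ x ∷ y ∷ z ∷ a ∷ b ∷ p ∷ q ∷ [] → u ∈ q ∷ a ∷ b ∷ p ∷ x ∷ z ∷ y ∷ []
            case (here e) = there (there (there (there (here e))))
            case (there (here e)) = there (there (there (there (there (there (here e))))))
            case (there (there (here e))) = there (there (there (there (there (here e)))))
            case (there (there (there (here e)))) = there (here e)
            case (there (there (there (there (here e))))) = there (there (here e))
            case (there (there (there (there (there (here e)))))) = there (there (there (here e)))
            case (there (there (there (there (there (there (here e))))))) = here e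
          cases (o ∷ o′ ∷ _) mM = ⊥-elim (at-most-two o o′ mM)

-- Neighbours obtained from the degrees

module _ {A : Set} where

  -- Pigeonhole: `y` and `z` can rule out at most two of the first three elements.
  third-element : {P : A → Set} → DecidableEquality A → {L : List A} → Unique L → All P L →
    length L ≥ 3 → (y z : A) → ∃[ a ] (P a × a ≢ y × a ≢ z)
  third-element _≟′_ {p ∷ q ∷ r ∷ _} ((p≢q ∷ p≢r ∷ _) ∷ (q≢r ∷ _) ∷ _) (pp ∷ pq ∷ pr ∷ _) _ y z
    with p ≟′ y | p ≟′ z | q ≟′ y | q ≟′ z
  ... | no f | no g | _ | _ = p , pp , f , g
  ... | _ | _ | no f | no g = q , pq , f , g
  ... | yes refl | _ | yes refl | _ = ⊥-elim (p≢q refl)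
  ... | yes refl | _ | no _ | yes refl = r , pr , ≢-sym p≢r , ≢-sym q≢r
  ... | no _ | yes refl | _ | yes refl = ⊥-elim (p≢q refl)
  ... | no _ | yes refl | yes refl | no _ = r , pr , ≢-sym q≢r , ≢-sym p≢r
  third-element _ {[]} _ _ ()
  third-element _ {_ ∷ []} _ _ (s≤s ())
  third-element _ {_ ∷ _ ∷ []} _ _ (s≤s (s≤s ()))

  pair-exhausted : (L : List A) → length L ≡ 2 → ∀ {x z u} → x ≢ z → x ∈ L → z ∈ L → u ∈ L →
    u ≡ x ⊎ u ≡ z
  pair-exhausted (p ∷ q ∷ []) _ x≢z (here refl) (here refl) _ = ⊥-elim (x≢z refl)
  pair-exhausted (p ∷ q ∷ []) _ x≢z (there (here refl)) (there (here refl)) _ = ⊥-elim (x≢z refl)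
  pair-exhausted (p ∷ q ∷ []) _ _ (here refl) (there (here refl)) (here e) = inj₁ e
  pair-exhausted (p ∷ q ∷ []) _ _ (here refl) (there (here refl)) (there (here e)) = inj₂ e
  pair-exhausted (p ∷ q ∷ []) _ _ (there (here refl)) (here refl) (here e) = inj₂ e
  pair-exhausted (p ∷ q ∷ []) _ _ (there (here refl)) (here refl) (there (here e)) = inj₁ e

module _ {n : ℕ} (G : Adj n) where

  new-neighbour : ∀ {x} → deg G x ≥ 3 → (y z : Fin n) → ∃[ a ] (T (G x a) × a ≢ y × a ≢ z)
  new-neighbour {x} d y z = third-element _≟_
    (AllPairs.filter⁺ (λ u → T? (G x u)) (allFin⁺ n)) (All.all-filter (λ u → T? (G x u)) (allFin n)) d y z

  only-neighbours : ∀ {x y z} → deg G y ≡ 2 → x ≢ z → T (G y x) → T (G y z) →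
    ∀ {u} → T (G y u) → u ≡ x ⊎ u ≡ z
  only-neighbours {y = y} d x≢z yx yz yu =
    pair-exhausted _ d x≢z (nbr yx) (nbr yz) (nbr yu)
    where
    nbr : ∀ {v} → T (G y v) → v ∈ filterᵇ (G y) (allFin n)
    nbr {v} = ∈-filter⁺ (λ u → T? (G y u)) (∈-allFin v)

theorem8 : {n : ℕ} (G : Adj n) → IsSimple G → Connected G → WellEdgeDominated G →
    (x y z : Fin n) → UniqueTriangle G x y z →
    deg G y ≡ 2 → deg G x ≥ 3 → deg G z ≥ 3 →
    Iso G House ⊎ Iso G DreamHouse
theorem8 G S conn W x y z ((x≢y , y≢z , x≢z , xy , yz , xz) , unique) dy dx dz
  with new-neighbour G dx y z | new-neighbour G dz y x
... | a , xa , a≢y , a≢z | b , zb , b≢y , b≢x =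
  House-or-DreamHouse conn xa (outside (≢-sym (~⇒≢ xa)) a≢y a≢z) zb (outside b≢x b≢y (≢-sym (~⇒≢ zb)))
  where
  open Graph G S
  open Equimatchable W
  roof : Roof x y z
  roof = record
    { xy = xy ; yz = yz ; xz = xz ; y-nbr = only-neighbours G dy x≢z (~-sym xy) yz
    ; tri = λ {u} {v} {w} e f g → proj₁ (unique u v w (~⇒≢ e , ~⇒≢ f , ~⇒≢ g , e , f , g)) }
  open TwoSided roof
  open Attached
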